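{- Let $G$ be a simple, undirected, finite graph and let $k$ be a positive integer. For every initial configuration $x(0)$ of the $k$-reversible process on $G$, the period length satisfies $p(x(0)) \leq 2$.
   Context: Let $V(G)=\{v_1,\dots,v_n\}$. A configuration is an assignment of a state in $\{ -1,+1\}$ to each vertex. In the $k$-reversible process on $G$ with initial configuration $x(0)$, $x_i(t)$ denotes the state of $v_i$ at discrete time $t=0,1,2,\dots$, and $x(t)=(x_1(t),\dots,x_n(t))$. Let $\mathit{op}_i(t)$ be the number of neighbors of $v_i$ whose state at time $t$ is different from $x_i(t)$. All vertices are updated simultaneously: $x_i(t+1)=-x_i(t)$ if $\mathit{op}_i(t)\geq k$, and $x_i(t+1)=x_i(t)$ otherwise. The period length $p(x(0))\ge 1$ and the transient length $\tau(x(0))\geq 0$ are the integers such that: $x(t+p(x(0)))=x(t)$ for all $t\geq\tau(x(0))$; and, for integers $t\ge 0$ and $q\geq 1$, $x(t+q)\neq x(t)$ whenever $t<\tau(x(0))$ or $q<p(x(0))$. -}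

module Defs where

open import Data.Bool.Base using (if_then_else_)
open import Data.Fin.Base using (Fin; zero; suc; toℕ; combine)
open import Data.Fin.Properties using (combine-injective; pigeonhole)
open import Data.Nat.Base
open import Data.Nat.Properties
open import Data.Product.Base using (∃; ∃₂; _×_; _,_; proj₁; proj₂)
open import Data.Sign.Base as Sign using (Sign; opposite)
open import Data.Sign.Properties using () renaming (_≟_ to _≟ˢ_)
open import Data.Sum.Base using (_⊎_; inj₁; inj₂)
open import Data.Vec.Base using (Vec; []; _∷_; lookup; tabulate; count; allFin)
open import Data.Vec.Properties using (≡-dec)
open import Function.Base using (_∘_)
open import Level using (0ℓ)
open import Relation.Binary.Core using (Rel)
open import Relation.Binary.Definitions
  using (Decidable; DecidableEquality; Symmetric; Irreflexive; tri<; tri≈; tri>)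
open import Relation.Binary.PropositionalEquality
open import Relation.Nullary.Decidable using (Dec; yes; no; does; ¬?; _×-dec_)
open import Relation.Nullary.Negation using (¬_; contradiction)

record Graph (n : ℕ) : Set₁ where
  field
    Adj        : Rel (Fin n) 0ℓ
    adj?       : Decidable Adj
    adj-sym    : Symmetric Adj
    adj-irrefl : Irreflexive _≡_ Adj

record IsPeriodTransient {A : Set} (x : ℕ → A) (p τ : ℕ) : Set where
  field
    positive : 1 ≤ p
    periodic : ∀ t → τ ≤ t → x (t + p) ≡ x t
    minimal  : ∀ t q → 1 ≤ q → t < τ ⊎ q < p → x (t + q) ≢ x t

module _ {A : Set} {x : ℕ → A} {p τ p′ τ′ : ℕ}
         (h : IsPeriodTransient x p τ) (h′ : IsPeriodTransient x p′ τ′) where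

  private
    module H  = IsPeriodTransient h
    module H′ = IsPeriodTransient h′

  period-unique : p ≡ p′
  period-unique with <-cmp p p′
  ... | tri≈ _ eq _ = eq
  ... | tri< lt _ _ = contradiction (H.periodic τ ≤-refl)
                        (H′.minimal τ p H.positive (inj₂ lt))
  ... | tri> _ _ gt = contradiction (H′.periodic τ′ ≤-refl)
                        (H.minimal τ′ p′ H′.positive (inj₂ gt))

  transient-unique : τ ≡ τ′
  transient-unique with <-cmp τ τ′
  ... | tri≈ _ eq _ = eq
  ... | tri< lt _ _ = contradiction (H.periodic τ ≤-refl)
                        (H′.minimal τ p H.positive (inj₁ lt))
  ... | tri> _ _ gt = contradiction (H′.periodic τ′ ≤-refl)
                        (H.minimal τ′ p′ H′.positive (inj₁ gt))

private
  least : {P : ℕ → Set} → (∀ m → Dec (P m)) → ∀ b → P b →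
          ∃ λ m → P m × (∀ j → j < m → ¬ P j)
  least P? zero    pb = zero , pb , λ _ ()
  least {P} P? (suc b) pb with P? zero
  ... | yes p0 = zero , p0 , λ _ ()
  ... | no ¬p0 with least {P ∘ suc} (P? ∘ suc) b pb
  ...   | m , pm , min = suc m , pm , below
    where
    below : ∀ j → j < suc m → ¬ P j
    below zero    _         = ¬p0
    below (suc j) (s≤s j<m) = min j j<m

-- For sequences generated by iterating a map, a single repetition
-- x j ≡ x i with i < j suffices for both lengths to exist.
module _ {A : Set} (_≟ᴬ_ : DecidableEquality A) (f : A → A)
         (x : ℕ → A) (x-suc : ∀ t → x (suc t) ≡ f (x t)) where

  private
    later : ∀ {a q} → x (a + q) ≡ x a → ∀ s → x ((s + a) + q) ≡ x (s + a)
    later e zero    = e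
    later e (suc s) = trans (x-suc _) (trans (cong f (later e s)) (sym (x-suc _)))

    from : ∀ {a q} → x (a + q) ≡ x a → ∀ t → a ≤ t → x (t + q) ≡ x t
    from {a} {q} e t a≤t =
      subst (λ u → x (u + q) ≡ x u) (m∸n+n≡m a≤t) (later e (t ∸ a))

    multiple : ∀ {a q} → x (a + q) ≡ x a → ∀ m t → a ≤ t → x (t + m * q) ≡ x t
    multiple e zero    t _   = cong x (+-identityʳ t)
    multiple {a} {q} e (suc m) t a≤t =
      trans (cong x (sym (+-assoc t q (m * q))))
        (trans (multiple e m (t + q) (≤-trans a≤t (m≤m+n t q))) (from e t a≤t))

    -- If x has period q from time t on and period d from time i on,
    -- then it has period d already from time t on.
    transfer : ∀ {t q i d} → 1 ≤ q → x (t + q) ≡ x t → x (i + d) ≡ x i →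
               x (t + d) ≡ x t
    transfer {t} {q} {i} {d} 1≤q et ei = begin
      x (t + d)            ≡⟨ multiple et i (t + d) (m≤m+n t d) ⟨
      x (t + d + i * q)    ≡⟨ cong x (+-assoc t d (i * q)) ⟩
      x (t + (d + i * q))  ≡⟨ cong (λ u → x (t + u)) (+-comm d (i * q)) ⟩
      x (t + (i * q + d))  ≡⟨ cong x (+-assoc t (i * q) d) ⟨
      x (t + i * q + d)    ≡⟨ from ei (t + i * q) i≤ ⟩
      x (t + i * q)        ≡⟨ multiple et i t ≤-refl ⟩
      x t                  ∎
      where
      open ≡-Reasoning
      i≤ : i ≤ t + i * q
      i≤ = ≤-trans (subst (_≤ i * q) (*-identityʳ i) (*-monoʳ-≤ i 1≤q))
                   (m≤n+m (i * q) t)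

  isPeriodTransient-exists : ∀ {i j} → i < j → x i ≡ x j →
                             ∃₂ λ p τ → IsPeriodTransient x p τ
  isPeriodTransient-exists {i} i<j eq with m<n⇒∃[o]m+1+o≡n i<j
    where
    m<n⇒∃[o]m+1+o≡n : ∀ {m n} → m < n → ∃ λ o → m + suc o ≡ n
    m<n⇒∃[o]m+1+o≡n {m} m<n = let o , e = m≤n⇒∃[o]m+o≡n m<n
                               in o , trans (+-suc m o) e
  ... | d , refl
    with least (λ t → x (t + suc d) ≟ᴬ x t) i (sym eq)
  ... | τ , eτ , τ-min
    with least (λ q → x (τ + suc q) ≟ᴬ x τ) d eτ
  ... | q , eq′ , q-min = suc q , τ , record
    { positive = s≤s z≤n
    ; periodic = from eq′
    ; minimal  = λ where
        t r       1≤r (inj₁ t<τ)       e → τ-min t t<τ (transfer 1≤r e eτ)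
        t (suc r) 1≤r (inj₂ (s≤s r<q)) e →
          q-min r r<q (transfer (s≤s z≤n) eq′ e)
    }

Configuration : ℕ → Set
Configuration n = Vec Sign n

module _ {n : ℕ} (G : Graph n) where
  open Graph G

  op : Configuration n → Fin n → ℕ
  op s i = count (λ j → adj? i j ×-dec ¬? (lookup s j ≟ˢ lookup s i)) (allFin n)

  module _ (k : ℕ) where

    step : Configuration n → Configuration n
    step s = tabulate λ i →
      if does (k ≤? op s i) then opposite (lookup s i) else lookup s i

    process : Configuration n → ℕ → Configuration n
    process x₀ zero    = x₀
    process x₀ (suc t) = step (process x₀ t)

private
  bit : Sign → Fin 2
  bit Sign.- = zero
  bit Sign.+ = suc zero

  bit-injective : ∀ a b → bit a ≡ bit b → a ≡ b
  bit-injective Sign.- Sign.- _ = refl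
  bit-injective Sign.+ Sign.+ _ = refl

  encode : ∀ {n} → Configuration n → Fin (2 ^ n)
  encode []      = zero
  encode (a ∷ s) = combine (bit a) (encode s)

  encode-injective : ∀ {n} (s t : Configuration n) → encode s ≡ encode t → s ≡ t
  encode-injective []      []      _ = refl
  encode-injective (a ∷ s) (b ∷ t) e
    with combine-injective (bit a) (encode s) (bit b) (encode t) e
  ... | ea , es = cong₂ _∷_ (bit-injective a b ea) (encode-injective s t es)

module _ {n : ℕ} (G : Graph n) (k : ℕ) (x₀ : Configuration n) where

  private
    lengths : ∃₂ λ p τ → IsPeriodTransient (process G k x₀) p τ
    lengths with pigeonhole (n<1+n (2 ^ n)) (λ i → encode (process G k x₀ (toℕ i)))
    ... | i , j , i<j , e =
      isPeriodTransient-exists (≡-dec _≟ˢ_) (step G k) (process G k x₀)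
        (λ _ → refl) i<j (encode-injective _ _ e)

  period : ℕ
  period = proj₁ lengths

  transient : ℕ
  transient = proj₁ (proj₂ lengths)

  -- By period-unique and transient-unique, this determines both numbers.
  period-transient : IsPeriodTransient (process G k x₀) period transient
  period-transient = proj₂ (proj₂ lengths)

{-# OPTIONS --safe #-}
-- Energy argument in the style of Goles and Olivos.  Let v be the current
-- configuration and charge a vertex i that is about to take the state a with
-- the number of neighbours whose current state differs from a, plus an inertia
-- term which is deg i + 1 if a = vᵢ and 2k if a ≠ vᵢ.  Keeping the state costs
-- op + deg + 1 and flipping it costs (deg − op) + 2k, so flipping is strictly
-- cheaper if op ≥ k and strictly dearer otherwise: the process always takes the
-- unique cheapest next configuration.  The total cost E(u, v) of moving from v
-- to u is symmetric, hence
--   E(x(t+2), x(t+1)) ≤ E(x(t), x(t+1)) = E(x(t+1), x(t)),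
-- with equality only if x(t+2) = x(t).  Within the period the energy is
-- constant, so there equality holds.
module Submission where

open import Defs
open import Data.Bool.Base using (Bool; true; false; if_then_else_)
open import Data.Fin.Base using (Fin; zero; suc)
open import Data.Nat.Base using (ℕ; zero; suc; _≤_; _<_; _+_; _*_; z≤n; s≤s)
open import Data.Nat.Properties
open import Data.Nat.Tactic.RingSolver using (solve-∀)
open import Data.Product.Base using (_,_)
open import Data.Sign.Base as Sign using (Sign; opposite)
open import Data.Sign.Properties using () renaming (_≟_ to _≟ˢ_)
open import Data.Sum.Base using (inj₂)
open import Data.Vec.Base using (lookup; tabulate; count)
open import Data.Vec.Properties using (lookup∘tabulate; tabulate∘lookup; tabulate-cong)
open import Function.Base using (_∘_; id)
open import Function.Bundles using (mk⇔)
open import Relation.Binary.PropositionalEquality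
open import Relation.Nullary.Decidable
  using (yes; no; does; ¬?; _×-dec_; does-⇔; dec-true; dec-false)
open import Relation.Nullary.Negation using (¬_; contradiction)
open import Relation.Unary using (Decidable)
open import Algebra.Properties.CommutativeMonoid.Sum +-0-commutativeMonoid
  using (sum; sum-syntax; sum-cong-≗; ∑-comm; ∑-distrib-+)

indicator : Bool → ℕ
indicator b = if b then 1 else 0

count-tabulate : ∀ {A : Set} {P : A → Set} (P? : Decidable P) {n} (f : Fin n → A) →
                 count P? (tabulate f) ≡ ∑[ j < n ] indicator (does (P? (f j)))
count-tabulate P? {zero}  f = refl
count-tabulate P? {suc n} f with does (P? (f zero))
... | true  = cong suc (count-tabulate P? (f ∘ suc))
... | false = count-tabulate P? (f ∘ suc)

sum-mono-≤ : ∀ {n} {f g : Fin n → ℕ} → (∀ i → f i ≤ g i) → sum f ≤ sum g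
sum-mono-≤ {zero}  f≤g = z≤n
sum-mono-≤ {suc n} f≤g = +-mono-≤ (f≤g zero) (sum-mono-≤ (f≤g ∘ suc))

-- Termwise bounds leave no slack once the totals agree: cancelling the tail sums settles the head,
-- cancelling the heads passes the hypothesis on to the tail.
sum-≤-tight : ∀ {n} {f g : Fin n → ℕ} → (∀ i → f i ≤ g i) → sum g ≤ sum f →
              ∀ i → g i ≤ f i
sum-≤-tight {suc n} {f} {g} f≤g Σg≤Σf zero =
  +-cancelʳ-≤ (sum (g ∘ suc)) (g zero) (f zero)
    (≤-trans Σg≤Σf (+-monoʳ-≤ (f zero) (sum-mono-≤ (f≤g ∘ suc))))
sum-≤-tight {suc n} {f} {g} f≤g Σg≤Σf (suc i) =
  sum-≤-tight (f≤g ∘ suc)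
    (+-cancelˡ-≤ (g zero) (sum (g ∘ suc)) (sum (f ∘ suc))
      (≤-trans Σg≤Σf (+-monoˡ-≤ (sum (f ∘ suc)) (f≤g zero)))) i

lookup-injective : ∀ {n} {s t : Configuration n} →
                   (∀ i → lookup s i ≡ lookup t i) → s ≡ t
lookup-injective {s = s} {t} eq =
  trans (sym (tabulate∘lookup s)) (trans (tabulate-cong eq) (tabulate∘lookup t))

antitone-steps : (e : ℕ → ℕ) → (∀ t → e (suc t) ≤ e t) → ∀ m t → e (m + t) ≤ e t
antitone-steps e e↓ zero    t = ≤-refl
antitone-steps e e↓ (suc m) t = ≤-trans (e↓ (m + t)) (antitone-steps e e↓ m t)

≢⇒opposite : ∀ {a b : Sign} → a ≢ b → a ≡ opposite b
≢⇒opposite {Sign.+} {Sign.+} a≢b = contradiction refl a≢b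
≢⇒opposite {Sign.+} {Sign.-} _   = refl
≢⇒opposite {Sign.-} {Sign.+} _   = refl
≢⇒opposite {Sign.-} {Sign.-} a≢b = contradiction refl a≢b

opposite-involutive : ∀ a → opposite (opposite a) ≡ a
opposite-involutive Sign.+ = refl
opposite-involutive Sign.- = refl

module _ {n : ℕ} (G : Graph n) where
  open Graph G

  -- The states are separate arguments because `energy` takes them from two different
  -- configurations.
  disagreement : Fin n → Fin n → Sign → Sign → ℕ
  disagreement i j a b = indicator (does (adj? i j ×-dec ¬? (b ≟ˢ a)))

  -- This is where undirectedness of the graph enters.
  disagreement-sym : ∀ i j a b → disagreement i j a b ≡ disagreement j i b a
  disagreement-sym i j a b = cong indicator
    (does-⇔ (mk⇔ (λ (e , b≢a) → adj-sym e , b≢a ∘ sym)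
                 (λ (e , a≢b) → adj-sym e , a≢b ∘ sym))
            (adj? i j ×-dec ¬? (b ≟ˢ a)) (adj? j i ×-dec ¬? (a ≟ˢ b)))

  degree : Fin n → ℕ
  degree i = ∑[ j < n ] indicator (does (adj? i j))

  opposing : Configuration n → Fin n → Sign → ℕ
  opposing s i a = ∑[ j < n ] disagreement i j a (lookup s j)

  op≡opposing : ∀ s i → op G s i ≡ opposing s i (lookup s i)
  op≡opposing s i =
    count-tabulate (λ j → adj? i j ×-dec ¬? (lookup s j ≟ˢ lookup s i)) id

  -- With only two states, each neighbour differs from exactly one of `a` and `opposite a`.
  opposing-+-opposite : ∀ s i a → opposing s i a + opposing s i (opposite a) ≡ degree i
  opposing-+-opposite s i a = trans
    (sym (∑-distrib-+ (λ j → disagreement i j a (lookup s j))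
                      (λ j → disagreement i j (opposite a) (lookup s j))))
    (sum-cong-≗ λ j → split j a (lookup s j))
    where
    split : ∀ j a b → disagreement i j a b + disagreement i j (opposite a) b
                    ≡ indicator (does (adj? i j))
    split j a b with does (adj? i j)
    split j a      b      | false = refl
    split j Sign.+ Sign.+ | true  = refl
    split j Sign.+ Sign.- | true  = refl
    split j Sign.- Sign.+ | true  = refl
    split j Sign.- Sign.- | true  = refl

  module _ (k : ℕ) where

    -- The `suc` breaks ties: keeping minus flipping comes to 2(op - k) + 1, which is odd, hence
    -- never zero, and positive at op = k, where the process flips.
    inertia : Fin n → Sign → Sign → ℕ
    inertia i a b = if does (a ≟ˢ b) then suc (degree i) else 2 * k

    inertia-sym : ∀ i a b → inertia i a b ≡ inertia i b a
    inertia-sym i Sign.+ Sign.+ = refl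
    inertia-sym i Sign.+ Sign.- = refl
    inertia-sym i Sign.- Sign.+ = refl
    inertia-sym i Sign.- Sign.- = refl

    inertia-keep : ∀ i a → inertia i a a ≡ suc (degree i)
    inertia-keep i Sign.+ = refl
    inertia-keep i Sign.- = refl

    inertia-flip : ∀ i a → inertia i (opposite a) a ≡ 2 * k
    inertia-flip i Sign.+ = refl
    inertia-flip i Sign.- = refl

    cost : Configuration n → Fin n → Sign → ℕ
    cost s i a = opposing s i a + inertia i a (lookup s i)

    energy : Configuration n → Configuration n → ℕ
    energy u v = ∑[ i < n ] cost v i (lookup u i)

    -- Exchanging the order of the double sum swaps the roles of the endpoints of each edge; the
    -- inertia terms are symmetric vertex by vertex.
    energy-sym : ∀ u v → energy u v ≡ energy v u
    energy-sym u v = begin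
      energy u v
        ≡⟨ ∑-distrib-+ (λ i → opposing v i (lookup u i)) _ ⟩
      (∑[ i < n ] ∑[ j < n ] disagreement i j (lookup u i) (lookup v j))
        + (∑[ i < n ] inertia i (lookup u i) (lookup v i))
        ≡⟨ cong₂ _+_
             (∑-comm (λ i j → disagreement i j (lookup u i) (lookup v j)))
             (sum-cong-≗ (λ i → inertia-sym i (lookup u i) (lookup v i))) ⟩
      (∑[ j < n ] ∑[ i < n ] disagreement i j (lookup u i) (lookup v j))
        + (∑[ i < n ] inertia i (lookup v i) (lookup u i))
        ≡⟨ cong (_+ (∑[ i < n ] inertia i (lookup v i) (lookup u i)))
             (sum-cong-≗ λ j → sum-cong-≗ λ i →
               disagreement-sym i j (lookup u i) (lookup v j)) ⟩
      (∑[ j < n ] ∑[ i < n ] disagreement j i (lookup v j) (lookup u i))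
        + (∑[ i < n ] inertia i (lookup v i) (lookup u i))
        ≡⟨ ∑-distrib-+ (λ j → opposing u j (lookup v j)) _ ⟨
      energy v u ∎
      where open ≡-Reasoning

    module _ (s : Configuration n) (i : Fin n) where

      private
        σ = lookup s i
        o = opposing s i σ
        o′ = opposing s i (opposite σ)

      -- Splitting the degree as `o + o′` exposes the summand `o′` shared with `cost-flip`, so only
      -- `o` and `k` remain to be compared.
      cost-keep : cost s i σ ≡ suc (o′ + 2 * o)
      cost-keep = begin
        o + inertia i σ σ   ≡⟨ cong (o +_) (inertia-keep i σ) ⟩
        o + suc (degree i)  ≡⟨ cong (λ d → o + suc d) (opposing-+-opposite s i σ) ⟨
        o + suc (o + o′)    ≡⟨ rearrange o o′ ⟩
        suc (o′ + 2 * o)    ∎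
        where
        open ≡-Reasoning
        rearrange : ∀ x y → x + suc (x + y) ≡ suc (y + 2 * x)
        rearrange = solve-∀

      cost-flip : cost s i (opposite σ) ≡ o′ + 2 * k
      cost-flip = cong (o′ +_) (inertia-flip i σ)

      step-flips : k ≤ op G s i → lookup (step G k s) i ≡ opposite σ
      step-flips k≤op = trans (lookup∘tabulate _ i)
        (cong (λ b → if b then opposite σ else σ) (dec-true (k ≤? op G s i) k≤op))

      step-keeps : ¬ k ≤ op G s i → lookup (step G k s) i ≡ σ
      step-keeps k≰op = trans (lookup∘tabulate _ i)
        (cong (λ b → if b then opposite σ else σ) (dec-false (k ≤? op G s i) k≰op))

      step-strictly-cheapest : ∀ {a} → a ≢ lookup (step G k s) i →
                               cost s i (lookup (step G k s) i) < cost s i a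
      step-strictly-cheapest a≢r with k ≤? op G s i
      ... | yes k≤op
        rewrite step-flips k≤op | trans (≢⇒opposite a≢r) (opposite-involutive σ)
              | cost-keep | cost-flip =
        s≤s (+-monoʳ-≤ o′ (*-monoʳ-≤ 2 (subst (k ≤_) (op≡opposing s i) k≤op)))
      ... | no k≰op
        rewrite step-keeps k≰op | ≢⇒opposite a≢r | cost-keep | cost-flip = begin
          -- One unit comes from `cost-keep`, the other from the strict inequality; `o < k` leaves
          -- room for exactly both.
          2 + (o′ + 2 * o)  ≡⟨ rearrange o o′ ⟩
          o′ + 2 * suc o    ≤⟨ +-monoʳ-≤ o′ (*-monoʳ-≤ 2 o<k) ⟩
          o′ + 2 * k        ∎
        where
        open ≤-Reasoning
        o<k : o < k
        o<k = subst (_< k) (op≡opposing s i) (≰⇒> k≰op)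
        rearrange : ∀ x y → 2 + (y + 2 * x) ≡ y + 2 * suc x
        rearrange = solve-∀

      step-cheapest : ∀ a → cost s i (lookup (step G k s) i) ≤ cost s i a
      step-cheapest a with a ≟ˢ lookup (step G k s) i
      ... | yes refl = ≤-refl
      ... | no a≢r   = <⇒≤ (step-strictly-cheapest a≢r)

    step-minimises : ∀ u s → energy (step G k s) s ≤ energy u s
    step-minimises u s = sum-mono-≤ λ i → step-cheapest s i (lookup u i)

    -- Equal totals force equal costs at every vertex, and there the cheapest state is unique.
    minimiser-unique : ∀ u s → energy u s ≤ energy (step G k s) s → u ≡ step G k s
    minimiser-unique u s u≤step = lookup-injective agree
      where
      tight : ∀ i → cost s i (lookup u i) ≤ cost s i (lookup (step G k s) i)
      tight = sum-≤-tight (λ i → step-cheapest s i (lookup u i)) u≤step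
      agree : ∀ i → lookup u i ≡ lookup (step G k s) i
      agree i with lookup u i ≟ˢ lookup (step G k s) i
      ... | yes eq = eq
      ... | no  ne = contradiction (tight i) (<⇒≱ (step-strictly-cheapest s i ne))

    module _ (x₀ : Configuration n) where

      private
        x = process G k x₀

      processEnergy : ℕ → ℕ
      processEnergy t = energy (x (suc t)) (x t)

      processEnergy-antitone : ∀ t → processEnergy (suc t) ≤ processEnergy t
      -- The previous configuration `x t` serves as a competitor to the successor of `x (suc t)`.
      processEnergy-antitone t = ≤-trans (step-minimises (x t) (x (suc t)))
        (≤-reflexive (energy-sym (x t) (x (suc t))))

      stationary⇒2-periodic : ∀ t → processEnergy t ≤ processEnergy (suc t) →
                              x (2 + t) ≡ x t
      stationary⇒2-periodic t e≤ = sym (minimiser-unique (x t) (x (suc t))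
        (≤-trans (≤-reflexive (energy-sym (x t) (x (suc t)))) e≤))

      -- A nonincreasing energy that returns to its initial value cannot have dropped at the first
      -- step; `1 ≤ p` guarantees that there is one.
      recurrent⇒2-periodic : ∀ t {p} → 1 ≤ p → x (t + p) ≡ x t → x (2 + t) ≡ x t
      recurrent⇒2-periodic t {suc q} _ recur = stationary⇒2-periodic t (begin
        processEnergy t            ≡⟨ cong (λ s → energy (step G k s) s) recur ⟨
        processEnergy (t + suc q)  ≡⟨ cong processEnergy (trans (+-suc t q) (+-comm (suc t) q)) ⟩
        processEnergy (q + suc t)  ≤⟨ antitone-steps processEnergy processEnergy-antitone q (suc t) ⟩
        processEnergy (suc t)      ∎)
        where open ≤-Reasoning

theorem3 : (n : ℕ) (G : Graph n) (k : ℕ) → 1 ≤ k → (x₀ : Configuration n) → period G k x₀ ≤ 2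
theorem3 n G k _ x₀ = ≮⇒≥ λ 2<p →
  -- If the period exceeded 2, minimality would forbid a return after two steps, yet recurrence at
  -- `τ` yields one.
  minimal τ 2 (s≤s z≤n) (inj₂ 2<p)
    (trans (cong (process G k x₀) (+-comm τ 2))
      (recurrent⇒2-periodic G k x₀ τ positive (periodic τ ≤-refl)))
  where
  open IsPeriodTransient (period-transient G k x₀)
  τ = transient G k x₀
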